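{- Let $A$ be a set, let $P,Q,R$ be predicates on $A$, and let $S$ be a binary relation on $A$. Then: (a) $\{P\}S\{Q\}\land\{R\}S\{\lnot Q\}\ \Rightarrow\ \forall x\,\lnot(P(x)\land R(x))$; (b) $\{P\}S\{Q\}\land\{P\}S\{\lnot Q\}\ \Leftrightarrow\ \forall x\,\lnot P(x)$; (c) $\big[\{P\}S\{\lnot Q\}\Rightarrow\lnot\{P\}S\{Q\}\big]\ \Leftrightarrow\ \exists x\,P(x)$; (d) $\{P\}S\{Q\}\land\{\lnot P\}S\{Q\}\ \Leftrightarrow\ \big[\forall x\,\exists y\,S(x,y)\ \land\ \forall x\,\forall z\,(S(x,z)\Rightarrow Q(z))\big]$; (e) $\exists x\,\exists z\,(S(x,z)\land\lnot Q(z))\ \Rightarrow\ \big[\{\lnot P\}S\{Q\}\Rightarrow\lnot\{P\}S\{Q\}\big]$.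
   Context: $A$ is an arbitrary set (the abstract state space); all quantified variables range over $A$. An $S$-predicate is a predicate $P:A\to\{\top,\bot\}$; an $S$-relation is an arbitrary binary relation $S\subseteq A\times A$, with $S(x,y)$ meaning $(x,y)\in S$ (neither totality nor determinism is assumed). Logical connectives applied to predicates are taken pointwise, so $\lnot Q$ is the predicate $x\mapsto\lnot Q(x)$. The total correctness formula $\{P\}S\{Q\}$ abbreviates $$\forall x\,[P(x)\Rightarrow(\exists y\,S(x,y)\ \land\ \forall z\,(S(x,z)\Rightarrow Q(z)))].$$ The logic is classical first-order predicate logic. -}

module Defs where

open import Data.Product using (_×_; ∃-syntax)
open import Level using (Level)
open import Relation.Binary.Core using (Rel)
open import Relation.Unary using (Pred)

private
  variable
    a ℓ : Level
    A : Set a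

infix 4 ⟪_⟫_⟪_⟫

-- The total correctness formula {P} S {Q}; braces are reserved in Agda.

⟪_⟫_⟪_⟫ : Pred A ℓ → Rel A ℓ → Pred A ℓ → Set _
⟪ P ⟫ S ⟪ Q ⟫ = ∀ x → P x → (∃[ y ] S x y) × (∀ z → S x z → Q z)

{-# OPTIONS --safe #-}
module Submission where

open import Axiom.ExcludedMiddle using (ExcludedMiddle)
open import Data.Empty using (⊥-elim)
open import Data.Product using (_×_; ∃-syntax; _,_; proj₁; proj₂)
open import Function.Base using (_∘_)
open import Function.Bundles using (_⇔_; mk⇔)
open import Level using (Level; _⊔_; Lift; lift; lower)
open import Relation.Binary.Core using (Rel)
open import Relation.Nullary using (¬_; yes; no)
open import Relation.Nullary.Decidable using (map′; decidable-stable)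
open import Relation.Unary using (Pred; ∁; Decidable)
open import Defs

-- At each state satisfying the precondition, a correctness formula gives both an outcome of `S` and
-- `Q` at every outcome. That outcome cannot satisfy both `Q` and `∁ Q`, so opposite postconditions
-- exclude a common state; with equal preconditions, none is left. Conversely, an empty precondition
-- makes every formula vacuous. Preconditions `P` and `∁ P` together cover all states. Excluded
-- middle serves to extract a witness of `P` and to decide `P x`.

private
  variable
    a ℓ : Level
    A : Set a
    P Q R : Pred A ℓ
    S : Rel A ℓ

-- `P x` lives at level `ℓ`, whereas `∃[ x ] P x` lives at `a ⊔ ℓ`; this lets one hypothesis decide
-- both.
lowerExcludedMiddle : ∀ a → ExcludedMiddle (a ⊔ ℓ) → ExcludedMiddle ℓ
lowerExcludedMiddle a em {X} = map′ lower lift (em {Lift a X})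

-- Since S has a value at x, the postconditions Q and ∁ Q collide there.
contradictory-posts⇒disjoint-pres :
  ⟪ P ⟫ S ⟪ Q ⟫ → ⟪ R ⟫ S ⟪ ∁ Q ⟫ → ∀ x → ¬ (P x × R x)
contradictory-posts⇒disjoint-pres PSQ RS∁Q x (px , rx) =
  let (y , sxy) , post = PSQ x px
      _ , ¬post = RS∁Q x rx
  in ¬post y sxy (post y sxy)

contradictory-posts⇒empty-pre :
  ⟪ P ⟫ S ⟪ Q ⟫ → ⟪ P ⟫ S ⟪ ∁ Q ⟫ → ∀ x → ¬ P x
contradictory-posts⇒empty-pre {Q = Q} PSQ PS∁Q x px =
  contradictory-posts⇒disjoint-pres {Q = Q} PSQ PS∁Q x (px , px)

empty-pre⇒correct : (∀ x → ¬ P x) → ⟪ P ⟫ S ⟪ Q ⟫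
empty-pre⇒correct ¬P x px = ⊥-elim (¬P x px)

complementary-pres⇒correct-everywhere : Decidable P →
  ⟪ P ⟫ S ⟪ Q ⟫ → ⟪ ∁ P ⟫ S ⟪ Q ⟫ → ∀ x → (∃[ y ] S x y) × (∀ z → S x z → Q z)
complementary-pres⇒correct-everywhere P? PSQ ∁PSQ x with P? x
... | yes px = PSQ x px
... | no ¬px = ∁PSQ x ¬px

incorrect-run⇒not-both : (∃[ x ] ∃[ z ] (S x z × ¬ Q z)) →
  ⟪ ∁ P ⟫ S ⟪ Q ⟫ → ¬ (⟪ P ⟫ S ⟪ Q ⟫)
incorrect-run⇒not-both (x , z , sxz , ¬qz) ∁PSQ PSQ =
  -- `P x` would force `Q z` through `PSQ`, so `x` satisfies `∁ P`; then `∁PSQ` forces `Q z` all the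
  -- same.
  ¬qz (proj₂ (∁PSQ x λ px → ¬qz (proj₂ (PSQ x px) z sxz)) z sxz)

theorem3p6 : ∀ {a ℓ : Level} → ExcludedMiddle (a ⊔ ℓ) →
    (A : Set a) (P Q R : Pred A ℓ) (S : Rel A ℓ) →
    ((⟪ P ⟫ S ⟪ Q ⟫) × (⟪ R ⟫ S ⟪ ∁ Q ⟫) → ∀ x → ¬ (P x × R x))
    × (((⟪ P ⟫ S ⟪ Q ⟫) × (⟪ P ⟫ S ⟪ ∁ Q ⟫)) ⇔ (∀ x → ¬ P x))
    × ((⟪ P ⟫ S ⟪ ∁ Q ⟫ → ¬ (⟪ P ⟫ S ⟪ Q ⟫)) ⇔ (∃[ x ] P x))
    × (((⟪ P ⟫ S ⟪ Q ⟫) × (⟪ ∁ P ⟫ S ⟪ Q ⟫)) ⇔ ((∀ x → ∃[ y ] S x y) × (∀ x z → S x z → Q z)))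
    × ((∃[ x ] ∃[ z ] (S x z × ¬ Q z)) → (⟪ ∁ P ⟫ S ⟪ Q ⟫ → ¬ (⟪ P ⟫ S ⟪ Q ⟫)))
theorem3p6 {a} {ℓ} em A P Q R S =
  (λ (PSQ , RS∁Q) → contradictory-posts⇒disjoint-pres {Q = Q} PSQ RS∁Q) ,
  mk⇔
    (λ (PSQ , PS∁Q) → contradictory-posts⇒empty-pre {Q = Q} PSQ PS∁Q)
    (λ ¬P → empty-pre⇒correct ¬P , empty-pre⇒correct ¬P) ,
  mk⇔
    -- By contradiction: without a witness of `P`, both formulas hold vacuously and so are
    -- compatible.
    (λ incompatible → decidable-stable em λ ∄P →
      let ¬P = λ x px → ∄P (x , px)
      in incompatible (empty-pre⇒correct ¬P) (empty-pre⇒correct ¬P))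
    (λ (x , px) PS∁Q PSQ → contradictory-posts⇒empty-pre {Q = Q} PSQ PS∁Q x px) ,
  mk⇔
    (λ (PSQ , ∁PSQ) →
      let correct = complementary-pres⇒correct-everywhere {Q = Q}
                      (λ _ → lowerExcludedMiddle a em) PSQ ∁PSQ
      in proj₁ ∘ correct , proj₂ ∘ correct)
    (λ (total , post) → (λ x _ → total x , post x) , (λ x _ → total x , post x)) ,
  incorrect-run⇒not-both {P = P}
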